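{- For every (not necessarily optimal) $(8,2)$-generator $\mathcal G$, $|\mathcal G^i|\ge \mathrm{constr}^i(8,2)$ for all $i=1,2,3,4$, and there exists $z\in[8]$ such that $|\{g\in\mathcal G: z\in g\}|\ge 2^{3}=8$. Moreover, $\mathrm{Constr}(8,2)$ is the unique optimal $(8,2)$-generator, i.e. every optimal $(8,2)$-generator is of the form $(\mathcal P(V_1)\cup\mathcal P(V_2))\setminus\{\emptyset\}$ for some partition $\{V_1,V_2\}$ of $[8]$ with $|V_1|=|V_2|=4$, and all these families are optimal.
   Context: $[n]=\{1,\dots,n\}$. An $(n,k)$-generator is a family $\mathcal G$ of subsets of $[n]$ such that every non-empty subset of $[n]$ is a disjoint union of at most $k$ members of $\mathcal G$; it is optimal if $|\mathcal G|$ is minimum among all $(n,k)$-generators. $\mathrm{Constr}(8,2):=(\mathcal P(V_1)\cup\mathcal P(V_2))\setminus\{\emptyset\}$ where $\{V_1,V_2\}$ is an arbitrary partition of $[8]$ into two sets of size $4$ (so $|\mathrm{Constr}(8,2)|=30$). For a family $\mathcal G$ of sets, $\mathcal G^i:=\{g\in\mathcal G:|g|\ge i\}$, and $\mathrm{constr}^i(8,2):=|\{g\in\mathrm{Constr}(8,2):|g|\ge i\}|$. -}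

module Defs where

open import Data.Bool.Base using (Bool; T; _∧_)
open import Data.Fin.Base using (Fin)
open import Data.Fin.Subset
  using (Subset; inside; outside; Nonempty; Empty; ⊤; _∪_; _∩_; ⋃; ∣_∣)
open import Data.Fin.Subset.Properties using (nonempty?; _⊆?_; _∈?_)
open import Data.List.Base using (List; []; _∷_; _++_; map; filterᵇ; length)
open import Data.List.Relation.Unary.All using (All)
open import Data.List.Relation.Unary.AllPairs using (AllPairs)
open import Data.Nat.Base using (ℕ; zero; suc; _≤_; _≤ᵇ_)
import Data.Vec.Base as Vec
open import Data.Product.Base using (_×_; ∃-syntax)
open import Relation.Binary.PropositionalEquality using (_≡_)
open import Relation.Nullary.Decidable using (⌊_⌋; _×-dec_; _⊎-dec_)

private
  variable
    n : ℕ

-- The ground set [n] is Fin n.  A family of subsets of [n] is given by its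
-- characteristic function, so two families are equal when they agree
-- pointwise.
Family : ℕ → Set
Family n = Subset n → Bool

infix 4 _∈ᶠ_
_∈ᶠ_ : Subset n → Family n → Set
A ∈ᶠ G = T (G A)

-- Every subset of [n], each listed exactly once.
subsets : ∀ n → List (Subset n)
subsets zero    = Vec.[] ∷ []
subsets (suc n) = map (outside Vec.∷_) (subsets n) ++ map (inside Vec.∷_) (subsets n)

card : Family n → ℕ
card {n} G = length (filterᵇ G (subsets n))

-- 𝒢ⁱ = { g ∈ 𝒢 : |g| ≥ i }
atLeast : ℕ → Family n → Family n
atLeast i G g = G g ∧ (i ≤ᵇ ∣ g ∣)

-- { g ∈ 𝒢 : z ∈ g }
star : Fin n → Family n → Family n
star z G g = G g ∧ ⌊ z ∈? g ⌋

Disjoint : Subset n → Subset n → Set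
Disjoint A B = Empty (A ∩ B)

-- A list satisfying AllPairs Disjoint can repeat only the empty set, which
-- affects neither the union nor the bound on the number of distinct members.
DisjointUnion≤ : ℕ → Family n → Subset n → Set
DisjointUnion≤ k G A =
  ∃[ gs ] length gs ≤ k × All (_∈ᶠ G) gs × AllPairs Disjoint gs × ⋃ gs ≡ A

IsGenerator : ℕ → Family n → Set
IsGenerator k G = ∀ A → Nonempty A → DisjointUnion≤ k G A

IsOptimalGenerator : ℕ → Family n → Set
IsOptimalGenerator {n} k G =
  IsGenerator k G × (∀ (H : Family n) → IsGenerator k H → card G ≤ card H)

record IsHalving (V₁ V₂ : Subset 8) : Set where
  field
    covers   : V₁ ∪ V₂ ≡ ⊤
    disjoint : Disjoint V₁ V₂
    size₁    : ∣ V₁ ∣ ≡ 4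
    size₂    : ∣ V₂ ∣ ≡ 4

-- (𝒫(V₁) ∪ 𝒫(V₂)) ∖ {∅}
Constr : Subset n → Subset n → Family n
Constr V₁ V₂ g = ⌊ nonempty? g ×-dec (g ⊆? V₁ ⊎-dec g ⊆? V₂) ⌋

-- A member of size s of a generator on n points avoids n − s of them, so the
-- members counted over all point deletions give
--   (n − i) |𝒢ⁱ| = Σᵥ |(𝒢 − v)ⁱ| + Σ_{j > i} |𝒢ʲ|.
-- For n = 8 this reduces the bounds 2, 10, 22 on |𝒢⁴|, |𝒢³|, |𝒢²| to the bounds
-- 1, 6, 15 for (7,2)-generators, and |𝒢¹| ≥ |𝒢²| + 8 since all singletons
-- are needed.  Summing the four bounds gives Σ |g| ≥ 64 = 8 · 8, hence the
-- point of degree 8.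
--
-- The bounds 15 and 6 on 7 points are found by search.  The same averaging,
-- applied to a smaller generator, yields an ordering of the points for which
-- the restriction to each final segment is small as well (for |𝒢²| ≤ 14: at
-- most 9, 5, 2, 1, 0 members on 6, 5, 4, 3, 2 points), and a backtracking search
-- over the ways to split each set refutes these budgets.
--
-- If |𝒢| = 30 then all these inequalities are equalities: 𝒢⁵ is empty, so [8]
-- splits into two members V, W of size 4, and descending from j = 3 to 1, a
-- j-subset X of V lies in 𝒢 because X ∪ W can only be split as X, W.
module Submission where

open import Defs
open import Data.Bool.Base using (Bool; true; false; T; not; _∧_; _∨_; if_then_else_)
open import Data.Bool.ListAction using (any; all)
open import Data.Bool.Properties using (T-∧; T-∨; T-≡)
open import Data.Empty using (⊥-elim)
open import Data.Fin.Base using (Fin; zero; suc)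
open import Data.Fin.Properties using (any?)
open import Data.Fin.Subset
  using (Subset; inside; outside; ⊤; ⊥; ∣_∣; _∪_; _∩_; _∈_; _⊆_; Nonempty; ∁)
open import Data.Fin.Subset.Properties
open import Data.List.Base using (List; []; _∷_; _++_; map; filterᵇ; length)
import Data.List.Membership.Propositional as List
open import Data.List.Membership.Propositional.Properties using (∈-map⁺; ∈-++⁺ˡ; ∈-++⁺ʳ)
open import Data.List.Properties using (filter-++; length-++)
open import Data.List.Relation.Unary.All as All using (All; []; _∷_)
open import Data.List.Relation.Unary.All.Properties using (map⁺; all⁺)
open import Data.List.Relation.Unary.AllPairs using ([]; _∷_)
open import Data.List.Relation.Unary.Any as Any using (Any; here; there)
open import Data.Maybe.Base as Maybe using (Maybe; just; nothing; maybe)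
open import Data.Nat.Base
open import Data.Nat.Properties
open import Data.Product.Base using (_×_; _,_; ∃₂; ∃-syntax; proj₁; proj₂)
open import Data.Sum.Base as Sum using (_⊎_; inj₁; inj₂; [_,_]′)
open import Data.Unit.Base using (tt) renaming (⊤ to Unit)
open import Data.Vec.Base using (Vec; []; _∷_; here; there; insertAt; head)
open import Function.Base using (_∘_)
open import Function.Bundles using (Equivalence)
open import Relation.Binary.PropositionalEquality
open import Relation.Nullary using (¬_; Dec; yes; no; contradiction)
open import Relation.Nullary.Decidable
  using (⌊_⌋; T?; isYes≗does; toWitness; fromWitness; from-no; _×-dec_; _⊎-dec_)
open import Algebra.Properties.CommutativeMonoid.Sum +-0-commutativeMonoid
  using (sum; sum-cong-≗; ∑-distrib-+)
open import Algebra.Properties.CommutativeSemigroup +-commutativeSemigroup using (interchange)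

private
  variable
    n : ℕ
    P Q A : Subset n

𝟙 : Bool → ℕ
𝟙 b = if b then 1 else 0

𝟙-mono : ∀ {a b} → (T a → T b) → 𝟙 a ≤ 𝟙 b
𝟙-mono {false} h = z≤n
𝟙-mono {true} {true} h = ≤-refl
𝟙-mono {true} {false} h = ⊥-elim (h _)

T-𝟙 : ∀ {b} → T b → 1 ≤ 𝟙 b
T-𝟙 {true} _ = ≤-refl

∑ : (Subset n → ℕ) → ℕ
∑ {zero} f = f []
∑ {suc n} f = ∑ (f ∘ (outside ∷_)) + ∑ (f ∘ (inside ∷_))

∑-cong : {f g : Subset n → ℕ} → f ≗ g → ∑ f ≡ ∑ g
∑-cong {zero} f≗g = f≗g []
∑-cong {suc n} f≗g = cong₂ _+_ (∑-cong (f≗g ∘ (outside ∷_))) (∑-cong (f≗g ∘ (inside ∷_)))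

∑-mono : {f g : Subset n → ℕ} → (∀ S → f S ≤ g S) → ∑ f ≤ ∑ g
∑-mono {zero} f≤g = f≤g []
∑-mono {suc n} f≤g = +-mono-≤ (∑-mono (f≤g ∘ (outside ∷_))) (∑-mono (f≤g ∘ (inside ∷_)))

∑-+ : (f g : Subset n → ℕ) → ∑ (λ S → f S + g S) ≡ ∑ f + ∑ g
∑-+ {zero} f g = refl
∑-+ {suc n} f g = trans (cong₂ _+_ (∑-+ (f ∘ (outside ∷_)) (g ∘ (outside ∷_))) (∑-+ (f ∘ (inside ∷_)) (g ∘ (inside ∷_))))
  (interchange (∑ (f ∘ (outside ∷_))) _ _ _)

∑-*ˡ : ∀ c (f : Subset n → ℕ) → ∑ (λ S → c * f S) ≡ c * ∑ f
∑-*ˡ {zero} c f = refl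
∑-*ˡ {suc n} c f = trans (cong₂ _+_ (∑-*ˡ c (f ∘ (outside ∷_))) (∑-*ˡ c (f ∘ (inside ∷_))))
  (sym (*-distribˡ-+ c (∑ (f ∘ (outside ∷_))) (∑ (f ∘ (inside ∷_)))))

∑-term : (f : Subset n → ℕ) (S : Subset n) → f S ≤ ∑ f
∑-term f [] = ≤-refl
∑-term f (outside ∷ S) = ≤-trans (∑-term (f ∘ (outside ∷_)) S) (m≤m+n _ _)
∑-term f (inside ∷ S) = ≤-trans (∑-term (f ∘ (inside ∷_)) S) (m≤n+m _ _)

∑-zero : (f : Subset n → ℕ) → (∀ S → f S ≡ 0) → ∑ f ≡ 0
∑-zero {zero} f h = h []
∑-zero {suc n} f h = cong₂ _+_ (∑-zero _ (h ∘ (outside ∷_))) (∑-zero _ (h ∘ (inside ∷_)))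

∑-tight : {f g : Subset n → ℕ} → (∀ S → f S ≤ g S) → ∑ g ≤ ∑ f → f ≗ g
∑-tight {zero} f≤g ∑g≤∑f [] = ≤-antisym (f≤g []) ∑g≤∑f
∑-tight {suc n} {f} {g} f≤g ∑g≤∑f = pointwise
  where
  f₀ = ∑ (f ∘ (outside ∷_))
  f₁ = ∑ (f ∘ (inside ∷_))
  g₀ = ∑ (g ∘ (outside ∷_))
  g₁ = ∑ (g ∘ (inside ∷_))
  pointwise : f ≗ g
  pointwise (outside ∷ S) = ∑-tight (f≤g ∘ (outside ∷_))
    (+-cancelʳ-≤ g₁ g₀ f₀ (≤-trans ∑g≤∑f (+-monoʳ-≤ f₀ (∑-mono (f≤g ∘ (inside ∷_)))))) S
  pointwise (inside ∷ S) = ∑-tight (f≤g ∘ (inside ∷_))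
    (+-cancelˡ-≤ g₀ g₁ f₁ (≤-trans ∑g≤∑f (+-monoˡ-≤ f₁ (∑-mono (f≤g ∘ (outside ∷_)))))) S

length-filterᵇ-map : ∀ {A B : Set} (p : B → Bool) (f : A → B) xs →
  length (filterᵇ p (map f xs)) ≡ length (filterᵇ (p ∘ f) xs)
length-filterᵇ-map p f [] = refl
length-filterᵇ-map p f (x ∷ xs) with p (f x)
... | true = cong suc (length-filterᵇ-map p f xs)
... | false = length-filterᵇ-map p f xs

card≡∑ : (G : Family n) → card G ≡ ∑ (𝟙 ∘ G)
card≡∑ {zero} G with G []
... | true = refl
... | false = refl
card≡∑ {suc n} G = begin
  length (filterᵇ G (map (outside ∷_) (subsets n) ++ map (inside ∷_) (subsets n)))
    ≡⟨ cong length (filter-++ (T? ∘ G) (map (outside ∷_) (subsets n)) _) ⟩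
  length (filterᵇ G (map (outside ∷_) (subsets n)) ++ filterᵇ G (map (inside ∷_) (subsets n)))
    ≡⟨ length-++ (filterᵇ G (map (outside ∷_) (subsets n))) ⟩
  length (filterᵇ G (map (outside ∷_) (subsets n))) + length (filterᵇ G (map (inside ∷_) (subsets n)))
    ≡⟨ cong₂ _+_ (length-filterᵇ-map G _ (subsets n)) (length-filterᵇ-map G _ (subsets n)) ⟩
  card (G ∘ (outside ∷_)) + card (G ∘ (inside ∷_))
    ≡⟨ cong₂ _+_ (card≡∑ (G ∘ (outside ∷_))) (card≡∑ (G ∘ (inside ∷_))) ⟩
  ∑ (𝟙 ∘ G) ∎
  where open ≡-Reasoning

card-mono : {F G : Family n} → (∀ S → T (F S) → T (G S)) → card F ≤ card G
card-mono {F = F} {G} F⊆G = subst₂ _≤_ (sym (card≡∑ F)) (sym (card≡∑ G)) (∑-mono (λ S → 𝟙-mono (F⊆G S)))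

𝟙-injective : ∀ {a b} → 𝟙 a ≡ 𝟙 b → a ≡ b
𝟙-injective {true} {true} _ = refl
𝟙-injective {false} {false} _ = refl

card-tight : {F G : Family n} → (∀ S → T (F S) → T (G S)) → card G ≤ card F → F ≗ G
card-tight {F = F} {G} F⊆G G≤F S =
  𝟙-injective (∑-tight (λ S → 𝟙-mono (F⊆G S)) (subst₂ _≤_ (card≡∑ G) (card≡∑ F) G≤F) S)

card-member : (G : Family n) {S : Subset n} → T (G S) → 1 ≤ card G
card-member G {S} S∈G = subst (1 ≤_) (sym (card≡∑ G)) (≤-trans (T-𝟙 S∈G) (∑-term (𝟙 ∘ G) S))

card≡0⇒∉ : (G : Family n) → card G ≤ 0 → ∀ S → ¬ T (G S)
card≡0⇒∉ G c≤0 S S∈G = contradiction (≤-trans (card-member G S∈G) c≤0) λ ()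

sum-≥ : ∀ {n} c (f : Fin n → ℕ) → (∀ v → c ≤ f v) → n * c ≤ sum f
sum-≥ {zero} c f c≤f = z≤n
sum-≥ {suc n} c f c≤f = +-mono-≤ (c≤f zero) (sum-≥ c (f ∘ suc) (c≤f ∘ suc))

sum-≤-any : ∀ {n} c (f : Fin n → ℕ) → sum f < n * suc c → ∃[ v ] f v ≤ c
sum-≤-any c f sum< with any? (λ v → f v ≤? c)
... | yes p = p
... | no ¬p = contradiction (sum-≥ (suc c) f (λ v → ≰⇒> λ h → ¬p (v , h))) (<⇒≱ sum<)

sum-≤ : ∀ {n} c (f : Fin n → ℕ) → (∀ v → f v ≤ c) → sum f ≤ n * c
sum-≤ {zero} c f f≤c = z≤n
sum-≤ {suc n} c f f≤c = +-mono-≤ (f≤c zero) (sum-≤ c (f ∘ suc) (f≤c ∘ suc))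

sum-≥-any : ∀ {n} c (f : Fin n → ℕ) → n * c < sum f → ∃[ v ] suc c ≤ f v
sum-≥-any c f sum> with any? (λ v → suc c ≤? f v)
... | yes p = p
... | no ¬p = contradiction (sum-≤ c f (λ v → ≮⇒≥ λ h → ¬p (v , h))) (<⇒≱ sum>)

sum-∑ : ∀ {m} (f : Fin m → Subset n → ℕ) → sum (λ v → ∑ (f v)) ≡ ∑ (λ S → sum (λ v → f v S))
sum-∑ {n} {zero} f = sym (∑-zero {n} (λ _ → 0) λ _ → refl)
sum-∑ {n} {suc m} f = trans (cong (∑ (f zero) +_) (sum-∑ (f ∘ suc))) (sym (∑-+ (f zero) (λ S → sum (λ v → f (suc v) S))))

∣insertAt∣ : ∀ (S : Subset n) v x → ∣ insertAt S v x ∣ ≡ ∣ x ∷ S ∣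
∣insertAt∣ S zero x = refl
∣insertAt∣ (outside ∷ S) (suc v) inside = ∣insertAt∣ S v inside
∣insertAt∣ (outside ∷ S) (suc v) outside = ∣insertAt∣ S v outside
∣insertAt∣ (inside ∷ S) (suc v) inside = cong suc (∣insertAt∣ S v inside)
∣insertAt∣ (inside ∷ S) (suc v) outside = cong suc (∣insertAt∣ S v outside)

∑-insertAt : (f : Subset (suc n) → ℕ) (v : Fin (suc n)) →
  ∑ (λ S → f (insertAt S v outside)) + ∑ (λ S → f (insertAt S v inside)) ≡ ∑ f
∑-insertAt f zero = refl
∑-insertAt {suc n} f (suc v) = trans
  (interchange (∑ λ S → f (outside ∷ insertAt S v outside)) _ _ _)
  (cong₂ _+_ (∑-insertAt (f ∘ (outside ∷_)) v) (∑-insertAt (f ∘ (inside ∷_)) v))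

_∖_ : Family (suc n) → Fin (suc n) → Family n
(G ∖ v) S = G (insertAt S v outside)

-- A set A arises as insertAt S v outside once for each v ∉ A.
sum-deletions : (f : Subset (suc n) → ℕ) →
  sum (λ v → ∑ (λ S → f (insertAt S v outside))) ≡ ∑ (λ A → (suc n ∸ ∣ A ∣) * f A)
sum-deletions {zero} f = sym (+-identityʳ _)
sum-deletions {suc n} f = begin
  ∑ f₀ + sum (λ v → ∑ (λ S → f₀ (insertAt S v outside)) + ∑ (λ S → f₁ (insertAt S v outside)))
    ≡⟨ cong (∑ f₀ +_) (∑-distrib-+ (λ v → ∑ (λ S → f₀ (insertAt S v outside))) (λ v → ∑ (λ S → f₁ (insertAt S v outside)))) ⟩
  ∑ f₀ + (sum (λ v → ∑ (λ S → f₀ (insertAt S v outside))) + sum (λ v → ∑ (λ S → f₁ (insertAt S v outside))))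
    ≡⟨ cong (∑ f₀ +_) (cong₂ _+_ (sum-deletions f₀) (sum-deletions f₁)) ⟩
  ∑ f₀ + (∑ (λ A → (suc n ∸ ∣ A ∣) * f₀ A) + ∑ (λ A → (suc n ∸ ∣ A ∣) * f₁ A))
    ≡⟨ +-assoc (∑ f₀) _ _ ⟨
  ∑ f₀ + ∑ (λ A → (suc n ∸ ∣ A ∣) * f₀ A) + ∑ (λ A → (suc n ∸ ∣ A ∣) * f₁ A)
    ≡⟨ cong (_+ ∑ (λ A → (suc n ∸ ∣ A ∣) * f₁ A)) (trans (sym (∑-+ f₀ (λ A → (suc n ∸ ∣ A ∣) * f₀ A)))
         (∑-cong λ A → cong (_* f₀ A) (sym (+-∸-assoc 1 (∣p∣≤n A))))) ⟩
  ∑ (λ A → (suc (suc n) ∸ ∣ A ∣) * f₀ A) + ∑ (λ A → (suc n ∸ ∣ A ∣) * f₁ A) ∎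
  where
  open ≡-Reasoning
  f₀ = f ∘ (outside ∷_)
  f₁ = f ∘ (inside ∷_)

tiers : ℕ → ℕ → ℕ → ℕ
tiers zero i s = 0
tiers (suc m) i s = 𝟙 (suc i ≤ᵇ s) + tiers m (suc i) s

tiers-≤ : ∀ m i s → tiers m i s ≤ s ∸ i
tiers-≤ zero i s = z≤n
tiers-≤ (suc m) i s with suc i ≤ᵇ s in eq
... | true = ≤-trans (s≤s (tiers-≤ m (suc i) s))
  (≤-reflexive (sym (+-∸-assoc 1 {s} {suc i} (≤ᵇ⇒≤ (suc i) s (subst T (sym eq) _)))))
... | false = ≤-trans (tiers-≤ m (suc i) s) (∸-monoʳ-≤ s (n≤1+n i))

cards : ℕ → ℕ → Family n → ℕ
cards zero i G = 0
cards (suc m) i G = card (atLeast (suc i) G) + cards m (suc i) G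

𝟙-∧ : ∀ a b → 𝟙 (a ∧ b) ≡ 𝟙 a * 𝟙 b
𝟙-∧ true b = sym (+-identityʳ _)
𝟙-∧ false b = refl

cards≡∑ : ∀ m i (G : Family n) → cards m i G ≡ ∑ (λ A → 𝟙 (G A) * tiers m i ∣ A ∣)
cards≡∑ zero i G = sym (∑-zero _ λ A → *-zeroʳ (𝟙 (G A)))
cards≡∑ (suc m) i G = trans
  (cong₂ _+_ (trans (card≡∑ (atLeast (suc i) G)) (∑-cong λ A → 𝟙-∧ (G A) (suc i ≤ᵇ ∣ A ∣))) (cards≡∑ m (suc i) G))
  (trans (sym (∑-+ (λ A → 𝟙 (G A) * 𝟙 (suc i ≤ᵇ ∣ A ∣)) (λ A → 𝟙 (G A) * tiers m (suc i) ∣ A ∣)))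
    (∑-cong λ A → sym (*-distribˡ-+ (𝟙 (G A)) (𝟙 (suc i ≤ᵇ ∣ A ∣)) _)))

-- A member of size s is avoided by n + 1 − s vertices and contributes at most
-- s − i to cards m i G.
deletion-average : ∀ m i (G : Family (suc n)) →
  sum (λ v → card (atLeast i (G ∖ v))) + cards m i G ≤ (suc n ∸ i) * card (atLeast i G)
deletion-average {n} m i G = begin
  sum (λ v → card (atLeast i (G ∖ v))) + cards m i G
    ≡⟨ cong₂ _+_ (sum-cong-≗ λ v → trans (card≡∑ (atLeast i (G ∖ v)))
         (∑-cong λ S → cong (λ s → 𝟙 (G (insertAt S v outside) ∧ (i ≤ᵇ s))) (sym (∣insertAt∣ S v outside))))
         (cards≡∑ m i G) ⟩
  sum (λ v → ∑ (λ S → 𝟙 (atLeast i G (insertAt S v outside)))) + ∑ (λ A → 𝟙 (G A) * tiers m i ∣ A ∣)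
    ≡⟨ cong (_+ ∑ (λ A → 𝟙 (G A) * tiers m i ∣ A ∣)) (sum-deletions (𝟙 ∘ atLeast i G)) ⟩
  ∑ (λ A → (suc n ∸ ∣ A ∣) * 𝟙 (atLeast i G A)) + ∑ (λ A → 𝟙 (G A) * tiers m i ∣ A ∣)
    ≡⟨ ∑-+ (λ A → (suc n ∸ ∣ A ∣) * 𝟙 (atLeast i G A)) (λ A → 𝟙 (G A) * tiers m i ∣ A ∣) ⟨
  ∑ (λ A → (suc n ∸ ∣ A ∣) * 𝟙 (atLeast i G A) + 𝟙 (G A) * tiers m i ∣ A ∣)
    ≤⟨ ∑-mono pointwise ⟩
  ∑ (λ A → (suc n ∸ i) * 𝟙 (atLeast i G A))
    ≡⟨ ∑-*ˡ (suc n ∸ i) (𝟙 ∘ atLeast i G) ⟩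
  (suc n ∸ i) * ∑ (𝟙 ∘ atLeast i G)
    ≡⟨ cong ((suc n ∸ i) *_) (card≡∑ (atLeast i G)) ⟨
  (suc n ∸ i) * card (atLeast i G) ∎
  where
  open ≤-Reasoning
  pointwise : ∀ A → (suc n ∸ ∣ A ∣) * 𝟙 (atLeast i G A) + 𝟙 (G A) * tiers m i ∣ A ∣ ≤ (suc n ∸ i) * 𝟙 (atLeast i G A)
  pointwise A with G A
  ... | false = ≤-reflexive (trans (+-identityʳ _) (trans (*-zeroʳ (suc n ∸ ∣ A ∣)) (sym (*-zeroʳ (suc n ∸ i)))))
  ... | true with i ≤ᵇ ∣ A ∣ in eq
  ...   | true = begin
    (suc n ∸ ∣ A ∣) * 1 + (tiers m i ∣ A ∣ + 0)
      ≤⟨ +-mono-≤ (≤-reflexive (*-identityʳ _)) (≤-trans (≤-reflexive (+-identityʳ _)) (tiers-≤ m i ∣ A ∣)) ⟩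
    (suc n ∸ ∣ A ∣) + (∣ A ∣ ∸ i)
      ≡⟨ +-∸-assoc (suc n ∸ ∣ A ∣) (≤ᵇ⇒≤ i ∣ A ∣ (subst T (sym eq) _)) ⟨
    (suc n ∸ ∣ A ∣) + ∣ A ∣ ∸ i
      ≡⟨ cong (_∸ i) (m∸n+n≡m (∣p∣≤n A)) ⟩
    suc n ∸ i
      ≡⟨ *-identityʳ _ ⟨
    (suc n ∸ i) * 1 ∎
  ...   | false = begin
    (suc n ∸ ∣ A ∣) * 0 + (tiers m i ∣ A ∣ + 0)
      ≤⟨ +-mono-≤ (≤-reflexive (*-zeroʳ (suc n ∸ ∣ A ∣))) (≤-trans (≤-reflexive (+-identityʳ _)) (tiers-≤ m i ∣ A ∣)) ⟩
    ∣ A ∣ ∸ i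
      ≡⟨ m≤n⇒m∸n≡0 {∣ A ∣} {i} (<⇒≤ (≰⇒> λ i≤s → subst T eq (≤⇒≤ᵇ i≤s))) ⟩
    0
      ≤⟨ z≤n ⟩
    (suc n ∸ i) * 0 ∎

sum-∈ : (A : Subset n) → sum (λ z → 𝟙 ⌊ z ∈? A ⌋) ≡ ∣ A ∣
sum-∈ [] = refl
sum-∈ (x ∷ A) = trans (cong (𝟙 ⌊ zero ∈? x ∷ A ⌋ +_) (trans (sum-cong-≗ suc-term) (sum-∈ A))) (zero-term x)
  where
  suc-term : ∀ z → 𝟙 ⌊ suc z ∈? x ∷ A ⌋ ≡ 𝟙 ⌊ z ∈? A ⌋
  suc-term z = cong 𝟙 (trans (isYes≗does (suc z ∈? x ∷ A)) (sym (isYes≗does (z ∈? A))))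
  zero-term : ∀ x → 𝟙 ⌊ zero ∈? x ∷ A ⌋ + ∣ A ∣ ≡ ∣ x ∷ A ∣
  zero-term inside = refl
  zero-term outside = refl

sum-*ˡ : ∀ {n} c (f : Fin n → ℕ) → sum (λ v → c * f v) ≡ c * sum f
sum-*ˡ {zero} c f = sym (*-zeroʳ c)
sum-*ˡ {suc n} c f = trans (cong (c * f zero +_) (sum-*ˡ c (f ∘ suc))) (sym (*-distribˡ-+ c (f zero) _))

sum-stars : ∀ m (G : Family n) → cards m 0 G ≤ sum (λ z → card (star z G))
sum-stars m G = begin
  cards m 0 G
    ≡⟨ cards≡∑ m 0 G ⟩
  ∑ (λ A → 𝟙 (G A) * tiers m 0 ∣ A ∣)
    ≤⟨ ∑-mono (λ A → *-monoʳ-≤ (𝟙 (G A)) (tiers-≤ m 0 ∣ A ∣)) ⟩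
  ∑ (λ A → 𝟙 (G A) * ∣ A ∣)
    ≡⟨ ∑-cong (λ A → trans (sum-cong-≗ λ z → 𝟙-∧ (G A) ⌊ z ∈? A ⌋)
         (trans (sum-*ˡ (𝟙 (G A)) (λ z → 𝟙 ⌊ z ∈? A ⌋)) (cong (𝟙 (G A) *_) (sum-∈ A)))) ⟨
  ∑ (λ A → sum (λ z → 𝟙 (star z G A)))
    ≡⟨ sum-∑ (λ z → 𝟙 ∘ star z G) ⟨
  sum (λ z → ∑ (𝟙 ∘ star z G))
    ≡⟨ sum-cong-≗ (λ z → card≡∑ (star z G)) ⟨
  sum (λ z → card (star z G)) ∎
  where open ≤-Reasoning

data Split : Subset n → Subset n → Subset n → Set where
  []      : Split [] [] []
  neither : Split P Q A → Split (outside ∷ P) (outside ∷ Q) (outside ∷ A)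
  left    : Split P Q A → Split (inside ∷ P) (outside ∷ Q) (inside ∷ A)
  right   : Split P Q A → Split (outside ∷ P) (inside ∷ Q) (inside ∷ A)

Split-size : Split P Q A → ∣ P ∣ + ∣ Q ∣ ≡ ∣ A ∣
Split-size [] = refl
Split-size (neither s) = Split-size s
Split-size (left s) = cong suc (Split-size s)
Split-size {P = _ ∷ P} (right s) = trans (+-suc ∣ P ∣ _) (cong suc (Split-size s))

Split-insertAt : ∀ (A : Subset n) v x → Split P Q (insertAt A v x) →
  ∃₂ λ y z → ∃₂ λ P′ Q′ → P ≡ insertAt P′ v y × Q ≡ insertAt Q′ v z × Split (y ∷ P′) (z ∷ Q′) (x ∷ A)
Split-insertAt A zero x s@(neither _) = _ , _ , _ , _ , refl , refl , s
Split-insertAt A zero x s@(left _) = _ , _ , _ , _ , refl , refl , s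
Split-insertAt A zero x s@(right _) = _ , _ , _ , _ , refl , refl , s
Split-insertAt (a ∷ A) (suc v) x (neither s) with Split-insertAt A v x s
... | _ , _ , _ , _ , refl , refl , neither s′ = _ , _ , _ , _ , refl , refl , neither (neither s′)
... | _ , _ , _ , _ , refl , refl , left s′ = _ , _ , _ , _ , refl , refl , left (neither s′)
... | _ , _ , _ , _ , refl , refl , right s′ = _ , _ , _ , _ , refl , refl , right (neither s′)
Split-insertAt (a ∷ A) (suc v) x (left s) with Split-insertAt A v x s
... | _ , _ , _ , _ , refl , refl , neither s′ = _ , _ , _ , _ , refl , refl , neither (left s′)
... | _ , _ , _ , _ , refl , refl , left s′ = _ , _ , _ , _ , refl , refl , left (left s′)
... | _ , _ , _ , _ , refl , refl , right s′ = _ , _ , _ , _ , refl , refl , right (left s′)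
Split-insertAt (a ∷ A) (suc v) x (right s) with Split-insertAt A v x s
... | _ , _ , _ , _ , refl , refl , neither s′ = _ , _ , _ , _ , refl , refl , neither (right s′)
... | _ , _ , _ , _ , refl , refl , left s′ = _ , _ , _ , _ , refl , refl , left (right s′)
... | _ , _ , _ , _ , refl , refl , right s′ = _ , _ , _ , _ , refl , refl , right (right s′)

-- 𝒢ⁱ ignores sets with fewer than i elements, so these may be assumed present.
Available : ℕ → Family n → Subset n → Set
Available i G S = ∣ S ∣ < i ⊎ T (G S)

Splits : ℕ → Family n → Set
Splits i G = ∀ A → ∃₂ λ P Q → Split P Q A × Available i G P × Available i G Q

Splits-mono : ∀ {i j} {G : Family n} → i ≤ j → Splits i G → Splits j G
Splits-mono i≤j g A with g A
... | P , Q , s , p , q = P , Q , s , Sum.map₁ (λ h → ≤-trans h i≤j) p , Sum.map₁ (λ h → ≤-trans h i≤j) q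

Available-insertAt : ∀ {i} (G : Family (suc n)) S v x → Available i G (insertAt S v x) →
  Available i (λ { (x ∷ S) → G (insertAt S v x) }) (x ∷ S)
Available-insertAt {i = i} G S v x = Sum.map₁ (subst (_< i) (∣insertAt∣ S v x))

Splits-∖ : ∀ {i} {G : Family (suc n)} v → Splits i G → Splits i (G ∖ v)
Splits-∖ {G = G} v g A with g (insertAt A v outside)
... | P , Q , s , p , q with Split-insertAt A v outside s
... | _ , _ , P′ , Q′ , refl , refl , neither s′ =
  P′ , Q′ , s′ , Available-insertAt G P′ v outside p , Available-insertAt G Q′ v outside q

-- The Lehmer code of a permutation of the ground set.
data Reordering : ℕ → Set where
  []  : Reordering 0
  _∷_ : Fin (suc n) → Reordering n → Reordering (suc n)

act : Reordering n → Subset n → Subset n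
act [] S = S
act (v ∷ r) (x ∷ S) = insertAt (act r S) v x

∣act∣ : ∀ (r : Reordering n) S → ∣ act r S ∣ ≡ ∣ S ∣
∣act∣ [] S = refl
∣act∣ (v ∷ r) (outside ∷ S) = trans (∣insertAt∣ (act r S) v outside) (∣act∣ r S)
∣act∣ (v ∷ r) (inside ∷ S) = trans (∣insertAt∣ (act r S) v inside) (cong suc (∣act∣ r S))

∑-act : ∀ (r : Reordering n) f → ∑ (f ∘ act r) ≡ ∑ f
∑-act [] f = refl
∑-act (v ∷ r) f = trans
  (cong₂ _+_ (∑-act r (λ S → f (insertAt S v outside))) (∑-act r (λ S → f (insertAt S v inside))))
  (∑-insertAt f v)

card-act : ∀ i (r : Reordering n) (G : Family n) → card (atLeast i (G ∘ act r)) ≡ card (atLeast i G)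
card-act i r G = trans (card≡∑ (atLeast i (G ∘ act r)))
  (trans (∑-cong λ S → cong (λ s → 𝟙 (G (act r S) ∧ (i ≤ᵇ s))) (sym (∣act∣ r S)))
  (trans (∑-act r (𝟙 ∘ atLeast i G)) (sym (card≡∑ (atLeast i G)))))

Split-act : ∀ (r : Reordering n) A → Split P Q (act r A) →
  ∃₂ λ P′ Q′ → P ≡ act r P′ × Q ≡ act r Q′ × Split P′ Q′ A
Split-act [] A s = _ , _ , refl , refl , s
Split-act (v ∷ r) (x ∷ A) s with Split-insertAt (act r A) v x s
... | _ , _ , _ , _ , refl , refl , neither s′ with Split-act r A s′
...   | _ , _ , refl , refl , s″ = _ , _ , refl , refl , neither s″
Split-act (v ∷ r) (x ∷ A) s | _ , _ , _ , _ , refl , refl , left s′ with Split-act r A s′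
...   | _ , _ , refl , refl , s″ = _ , _ , refl , refl , left s″
Split-act (v ∷ r) (x ∷ A) s | _ , _ , _ , _ , refl , refl , right s′ with Split-act r A s′
...   | _ , _ , refl , refl , s″ = _ , _ , refl , refl , right s″

Splits-act : ∀ {i} {G : Family n} r → Splits i G → Splits i (G ∘ act r)
Splits-act {i = i} r g A with g (act r A)
... | P , Q , s , p , q with Split-act r A s
... | P′ , Q′ , refl , refl , s′ =
  P′ , Q′ , s′ , Sum.map₁ (subst (_< i) (∣act∣ r P′)) p , Sum.map₁ (subst (_< i) (∣act∣ r Q′)) q

large-member : ∀ i {G : Family n} → i + i < n → Splits i G → 1 ≤ card (atLeast (suc i) G)
large-member {n} i {G} 2i<n g with g ⊤
... | P , Q , s , p , q = larger (i <? ∣ P ∣)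
  where
  size : ∣ P ∣ + ∣ Q ∣ ≡ n
  size = trans (Split-size s) (∣⊤∣≡n n)
  member : ∀ {S} → i < ∣ S ∣ → Available i G S → 1 ≤ card (atLeast (suc i) G)
  member i<S (inj₁ S<i) = contradiction S<i (<⇒≯ i<S)
  member i<S (inj₂ S∈G) = card-member (atLeast (suc i) G) (Equivalence.from T-∧ (S∈G , ≤⇒≤ᵇ i<S))
  larger : Dec (i < ∣ P ∣) → 1 ≤ card (atLeast (suc i) G)
  larger (yes i<P) = member i<P p
  larger (no i≮P) = member (+-cancelˡ-< i i ∣ Q ∣
    (≤-trans 2i<n (≤-trans (≤-reflexive (sym size)) (+-monoˡ-≤ ∣ Q ∣ (≮⇒≥ i≮P))))) q

-- Bounded i (bₙ ∷ … ∷ b₁ ∷ []) G: at most bₖ members of size ≥ i avoid the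
-- first n − k vertices.
Bounded : ℕ → Vec ℕ n → Family n → Set
Bounded i [] G = Unit
Bounded i (b ∷ bs) G = card (atLeast i G) ≤ b × Bounded i bs (G ∘ (outside ∷_))

feasible : ℕ → Vec ℕ n → Bool
feasible i [] = true
feasible i (b ∷ []) = true
feasible {n} i (b ∷ b′ ∷ bs) =
  ((n ∸ i) * b <ᵇ 𝟙 (i + i <ᵇ n) + n * suc b′) ∧ feasible i (b′ ∷ bs)

cheap-deletion : ∀ i b b′ {G : Family (suc n)} →
  T ((suc n ∸ i) * b <ᵇ 𝟙 (i + i <ᵇ suc n) + suc n * suc b′) →
  Splits i G → card (atLeast i G) ≤ b → ∃[ v ] card (atLeast i (G ∖ v)) ≤ b′
cheap-deletion {n} i b b′ {G} gap g G≤b =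
  sum-≤-any b′ f (+-cancelˡ-< (𝟙 (i + i <ᵇ suc n)) _ _ (begin-strict
    𝟙 (i + i <ᵇ suc n) + sum f      ≡⟨ +-comm _ (sum f) ⟩
    sum f + 𝟙 (i + i <ᵇ suc n)      ≤⟨ +-monoʳ-≤ (sum f) larger ⟩
    sum f + cards 1 i G             ≤⟨ deletion-average 1 i G ⟩
    (suc n ∸ i) * card (atLeast i G) ≤⟨ *-monoʳ-≤ (suc n ∸ i) G≤b ⟩
    (suc n ∸ i) * b                 <⟨ <ᵇ⇒< _ _ gap ⟩
    𝟙 (i + i <ᵇ suc n) + suc n * suc b′ ∎))
  where
  open ≤-Reasoning
  f : Fin (suc n) → ℕ
  f v = card (atLeast i (G ∖ v))
  larger : 𝟙 (i + i <ᵇ suc n) ≤ cards 1 i G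
  larger with i + i <ᵇ suc n in eq
  ... | false = z≤n
  ... | true = ≤-trans (large-member i (<ᵇ⇒< _ _ (subst T (sym eq) _)) g) (m≤m+n _ 0)

ordering : ∀ i (bs : Vec ℕ (suc n)) {G : Family (suc n)} → T (feasible i bs) →
  Splits i G → card (atLeast i G) ≤ head bs → ∃[ r ] Bounded i bs (G ∘ act r)
ordering i (b ∷ []) {G} _ g G≤b =
  zero ∷ [] , ≤-trans (≤-reflexive (card-act i (zero ∷ []) G)) G≤b , _
ordering i (b ∷ b′ ∷ bs) {G} feas g G≤b
  with gap , feas′ ← Equivalence.to T-∧ feas
  with v , Gv≤b′ ← cheap-deletion i b b′ gap g G≤b
  with r , bounded ← ordering i (b′ ∷ bs) feas′ (Splits-∖ v g) Gv≤b′
  = v ∷ r , ≤-trans (≤-reflexive (card-act i (v ∷ r) G)) G≤b , bounded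

data Cell : Set where
  present absent unknown : Cell

-- A binary trie with a cell for every subset; the number at a node bounds how
-- many unknown cells below it may still turn out to be present.
data Table : ℕ → Set where
  leaf : Cell → Table 0
  node : ℕ → Table n → Table n → Table (suc n)

status : Table n → Subset n → Cell
status (leaf c) [] = c
status (node _ l r) (outside ∷ S) = status l S
status (node _ l r) (inside ∷ S) = status r S

insert : Subset n → Table n → Maybe (Table n)
insert [] (leaf c) = just (leaf present)
insert (_ ∷ _) (node zero l r) = nothing
insert (outside ∷ S) (node (suc b) l r) = Maybe.map (λ l′ → node b l′ r) (insert S l)
insert (inside ∷ S) (node (suc b) l r) = Maybe.map (node b l) (insert S r)

exclude : Subset n → Table n → Table n
exclude [] (leaf c) = leaf absent
exclude (outside ∷ S) (node b l r) = node b (exclude S l) r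
exclude (inside ∷ S) (node b l r) = node b l (exclude S r)

Option : ℕ → Set
Option n = Subset n × Subset n

splits halves : Subset n → List (Option n)
splits [] = ([] , []) ∷ []
splits (outside ∷ A) = map (λ (P , Q) → outside ∷ P , outside ∷ Q) (splits A)
splits (inside ∷ A) = map (λ (P , Q) → outside ∷ P , inside ∷ Q) (splits A)
                   ++ map (λ (P , Q) → inside ∷ P , outside ∷ Q) (splits A)
halves [] = ([] , []) ∷ []
halves (outside ∷ A) = map (λ (P , Q) → outside ∷ P , outside ∷ Q) (halves A)
halves (inside ∷ A) = map (λ (P , Q) → inside ∷ P , outside ∷ Q) (splits A)

is-present : Cell → Bool
is-present present = true
is-present _ = false

satisfied : Table n → Option n → Bool
satisfied t (P , Q) = is-present (status t P) ∧ is-present (status t Q)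

require : Subset n → (Table n → Bool) → Table n → Bool
require S k t with status t S
... | present = k t
... | absent = true
... | unknown = maybe k true (insert S t)

-- What follows for the table once the option is known not to be available.
forbid : Option n → Table n → Table n
forbid (P , Q) t with status t P | status t Q
... | present | unknown = exclude Q t
... | unknown | present = exclude P t
... | _ | _ = t

refutes : List (List (Option n)) → Table n → Bool
branch : List (Option n) → List (List (Option n)) → Table n → Bool
refutes [] t = false
refutes (os ∷ oss) t = if any (satisfied t) os then refutes oss t else branch os oss t
branch [] oss t = true
branch ((P , Q) ∷ os) oss t =
  require P (require Q (refutes oss)) t ∧ branch os oss (forbid (P , Q) t)

-- The bounds 2 ^ n are vacuous.
full : ∀ n → ℕ → Table n
full zero zero = leaf unknown
full zero (suc i) = leaf present
full (suc n) i = node (2 ^ suc n) (full n i) (full n (pred i))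

start : ℕ → Vec ℕ n → Table n
start {zero} i [] = full zero i
start {suc n} i (b ∷ bs) = node b (start i bs) (full n (pred i))

Split⇒∈splits : Split P Q A → (P , Q) List.∈ splits A
Split⇒∈splits [] = here refl
Split⇒∈splits (neither s) = ∈-map⁺ _ (Split⇒∈splits s)
Split⇒∈splits {A = _ ∷ A} (left s) = ∈-++⁺ʳ (map _ (splits A)) (∈-map⁺ _ (Split⇒∈splits s))
Split⇒∈splits (right s) = ∈-++⁺ˡ (∈-map⁺ _ (Split⇒∈splits s))

Split-swap : Split P Q A → Split Q P A
Split-swap [] = []
Split-swap (neither s) = neither (Split-swap s)
Split-swap (left s) = right (Split-swap s)
Split-swap (right s) = left (Split-swap s)

Split⇒∈halves : Split P Q A → (P , Q) List.∈ halves A ⊎ (Q , P) List.∈ halves A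
Split⇒∈halves [] = inj₁ (here refl)
Split⇒∈halves (neither s) with Split⇒∈halves s
... | inj₁ h = inj₁ (∈-map⁺ _ h)
... | inj₂ h = inj₂ (∈-map⁺ _ h)
Split⇒∈halves (left s) = inj₁ (∈-map⁺ _ (Split⇒∈splits s))
Split⇒∈halves (right s) = inj₂ (∈-map⁺ _ (Split⇒∈splits (Split-swap s)))

free : Family n → Table n → ℕ
free G (leaf unknown) = 𝟙 (G [])
free G (leaf _) = 0
free G (node _ l r) = free (G ∘ (outside ∷_)) l + free (G ∘ (inside ∷_)) r

infix 4 _⊨_
_⊨_ : Family n → Table n → Set
G ⊨ leaf present = T (G [])
G ⊨ leaf absent = ¬ T (G [])
G ⊨ leaf unknown = Unit
G ⊨ t@(node b l r) = free G t ≤ b × G ∘ (outside ∷_) ⊨ l × G ∘ (inside ∷_) ⊨ r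

present⇒∈ : ∀ {G : Family n} t S → G ⊨ t → status t S ≡ present → T (G S)
present⇒∈ (leaf present) [] m refl = m
present⇒∈ (node _ l r) (outside ∷ S) (_ , m , _) eq = present⇒∈ l S m eq
present⇒∈ (node _ l r) (inside ∷ S) (_ , _ , m) eq = present⇒∈ r S m eq

absent⇒∉ : ∀ {G : Family n} t S → G ⊨ t → status t S ≡ absent → ¬ T (G S)
absent⇒∉ (leaf absent) [] m refl = m
absent⇒∉ (node _ l r) (outside ∷ S) (_ , m , _) eq = absent⇒∉ l S m eq
absent⇒∉ (node _ l r) (inside ∷ S) (_ , _ , m) eq = absent⇒∉ r S m eq

insert-sound : ∀ {G : Family n} t S → G ⊨ t → status t S ≡ unknown → T (G S) →
  ∃[ t′ ] insert S t ≡ just t′ × G ⊨ t′ × free G t ≡ suc (free G t′)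
insert-sound {G = G} (leaf unknown) [] m refl S∈G with G [] in eq
... | true = leaf present , refl , subst T (sym eq) _ , refl
insert-sound {G = G} (node b l r) (outside ∷ S) (f≤b , ml , mr) eq S∈G
  with l′ , eq′ , ml′ , fl ← insert-sound l S ml eq S∈G
  with suc b ← b | s≤s f≤b ← subst (λ f → f + free (G ∘ (inside ∷_)) r ≤ b) fl f≤b
  rewrite eq′ = node b l′ r , refl , (f≤b , ml′ , mr) , cong (_+ free (G ∘ (inside ∷_)) r) fl
insert-sound {G = G} (node b l r) (inside ∷ S) (f≤b , ml , mr) eq S∈G
  with r′ , eq′ , mr′ , fr ← insert-sound r S mr eq S∈G
  with fr′ ← trans (cong (free (G ∘ (outside ∷_)) l +_) fr) (+-suc (free (G ∘ (outside ∷_)) l) _)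
  with suc b ← b | s≤s f≤b ← subst (_≤ b) fr′ f≤b
  rewrite eq′ = node b l r′ , refl , (f≤b , ml , mr′) , fr′

exclude-sound : ∀ {G : Family n} t S → G ⊨ t → ¬ T (G S) →
  G ⊨ exclude S t × free G (exclude S t) ≤ free G t
exclude-sound (leaf _) [] m S∉G = S∉G , z≤n
exclude-sound {G = G} (node b l r) (outside ∷ S) (f≤b , ml , mr) S∉G
  with ml′ , fl ← exclude-sound l S ml S∉G =
  (≤-trans f≤ f≤b , ml′ , mr) , f≤
  where f≤ = +-monoˡ-≤ (free (G ∘ (inside ∷_)) r) fl
exclude-sound {G = G} (node b l r) (inside ∷ S) (f≤b , ml , mr) S∉G
  with mr′ , fr ← exclude-sound r S mr S∉G =
  (≤-trans f≤ f≤b , ml , mr′) , f≤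
  where f≤ = +-monoʳ-≤ (free (G ∘ (outside ∷_)) l) fr

Chosen : Family n → Option n → Set
Chosen G (P , Q) = T (G P) × T (G Q)

require-sound : ∀ {G : Family n} S k t → G ⊨ t → T (G S) →
  T (require S k t) → ∃[ t′ ] G ⊨ t′ × T (k t′)
require-sound S k t m S∈G ok with status t S in eq
... | present = t , m , ok
... | absent = contradiction S∈G (absent⇒∉ t S m eq)
... | unknown with t′ , eq′ , m′ , _ ← insert-sound t S m eq S∈G rewrite eq′ = t′ , m′ , ok

forbid-sound : ∀ {G : Family n} o t → G ⊨ t → ¬ Chosen G o → G ⊨ forbid o t
forbid-sound (P , Q) t m ¬c with status t P in eqP | status t Q in eqQ
... | present | present = m
... | present | absent = m
... | present | unknown = proj₁ (exclude-sound t Q m λ q → ¬c (present⇒∈ t P m eqP , q))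
... | absent | _ = m
... | unknown | present = proj₁ (exclude-sound t P m λ p → ¬c (p , present⇒∈ t Q m eqQ))
... | unknown | absent = m
... | unknown | unknown = m

refutes-sound : ∀ {G : Family n} oss t → T (refutes oss t) → G ⊨ t → ¬ All (Any (Chosen G)) oss
branch-sound : ∀ {G : Family n} os oss t → T (branch os oss t) → G ⊨ t →
  Any (Chosen G) os → ¬ All (Any (Chosen G)) oss
refutes-sound (os ∷ oss) t ok m (c ∷ cs) with any (satisfied t) os
... | true = refutes-sound oss t ok m cs
... | false = branch-sound os oss t ok m c cs
branch-sound {G = G} ((P , Q) ∷ os) oss t ok m c cs
  with ok₁ , ok₂ ← Equivalence.to T-∧ ok | T? (G P) ×-dec T? (G Q)
... | yes (P∈G , Q∈G)
  with t′ , m′ , ok′ ← require-sound P (require Q (refutes oss)) t m P∈G ok₁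
  with t″ , m″ , ok″ ← require-sound Q (refutes oss) t′ m′ Q∈G ok′
  = refutes-sound oss t″ ok″ m″ cs
... | no ¬c = branch-sound os oss (forbid (P , Q) t) ok₂ (forbid-sound (P , Q) t m ¬c) (Any.tail ¬c c) cs

pad : ℕ → Family n → Family n
pad i G S = G S ∨ (∣ S ∣ <ᵇ i)

Available⇒pad : ∀ {i} {G : Family n} {S} → Available i G S → T (pad i G S)
Available⇒pad (inj₁ S<i) = Equivalence.from T-∨ (inj₂ (<⇒<ᵇ S<i))
Available⇒pad (inj₂ S∈G) = Equivalence.from T-∨ (inj₁ S∈G)

free-≤ : ∀ (G : Family n) t → free G t ≤ 2 ^ n
free-≤ G (leaf unknown) with G []
... | true = ≤-refl
... | false = z≤n
free-≤ G (leaf present) = z≤n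
free-≤ G (leaf absent) = z≤n
free-≤ {suc n} G (node _ l r) = +-mono-≤ (free-≤ _ l) (≤-trans (free-≤ _ r) (≤-reflexive (sym (+-identityʳ _))))

≤ᵇ-pred : ∀ i s → (pred i ≤ᵇ s) ≡ (i ≤ᵇ suc s)
≤ᵇ-pred zero s = refl
≤ᵇ-pred (suc zero) s = refl
≤ᵇ-pred (suc (suc i)) s = refl

free-full : ∀ i (G : Family n) → free G (full n i) ≡ ∑ (𝟙 ∘ atLeast i G)
free-full {zero} zero G with G []
... | true = refl
... | false = refl
free-full {zero} (suc i) G with G []
... | true = refl
... | false = refl
free-full {suc n} i G = cong₂ _+_ (free-full i (G ∘ (outside ∷_)))
  (trans (free-full (pred i) (G ∘ (inside ∷_)))
    (∑-cong λ S → cong (λ b → 𝟙 (G (inside ∷ S) ∧ b)) (≤ᵇ-pred i ∣ S ∣)))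

free-start : ∀ i (bs : Vec ℕ n) (G : Family n) → free G (start i bs) ≡ free G (full n i)
free-start i [] G = refl
free-start i (b ∷ bs) G = cong (_+ free (G ∘ (inside ∷_)) (full _ (pred i))) (free-start i bs (G ∘ (outside ∷_)))

<pred⇒suc< : ∀ {s} i → s < pred i → suc s < i
<pred⇒suc< (suc i) s<i = s≤s s<i

full-sound : ∀ i {G : Family n} → (∀ S → ∣ S ∣ < i → T (G S)) → G ⊨ full n i
full-sound {zero} zero small = _
full-sound {zero} (suc i) small = small [] (s≤s z≤n)
full-sound {suc n} i {G} small =
  free-≤ G (full (suc n) i) , full-sound i (small ∘ (outside ∷_)) ,
  full-sound (pred i) λ S S<i → small (inside ∷ S) (<pred⇒suc< i S<i)

atLeast-pad : ∀ i (G : Family n) → atLeast i (pad i G) ≗ atLeast i G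
atLeast-pad i G S with G S | ∣ S ∣ <ᵇ i in S<i | i ≤ᵇ ∣ S ∣ in i≤S
... | true | _ | _ = refl
... | false | false | _ = refl
... | false | true | false = refl
... | false | true | true =
  contradiction (<ᵇ⇒< ∣ S ∣ i (Equivalence.from T-≡ S<i)) (≤⇒≯ (≤ᵇ⇒≤ i ∣ S ∣ (Equivalence.from T-≡ i≤S)))

start-sound : ∀ i (bs : Vec ℕ n) {G : Family n} → Bounded i bs G → pad i G ⊨ start i bs
start-sound i [] {G} _ = full-sound {0} i λ S S<i → Available⇒pad {G = G} {S} (inj₁ S<i)
start-sound i (b ∷ bs) {G} (G≤b , bounded) =
  ≤-trans (≤-reflexive count) G≤b , start-sound i bs bounded ,
  full-sound (pred i) λ S S<i → Available⇒pad {G = G} {inside ∷ S} (inj₁ (<pred⇒suc< i S<i))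
  where
  count : free (pad i G) (start i (b ∷ bs)) ≡ card (atLeast i G)
  count = trans (free-start i (b ∷ bs) (pad i G)) (trans (free-full i (pad i G))
    (trans (∑-cong (cong 𝟙 ∘ atLeast-pad i G)) (sym (card≡∑ (atLeast i G)))))

refuted⇒¬Bounded : ∀ i (bs : Vec ℕ n) {G : Family n} →
  refutes (map halves (subsets n)) (start i bs) ≡ true → Splits i G → ¬ Bounded i bs G
refuted⇒¬Bounded i bs {G} ok g bounded =
  refutes-sound (map halves (subsets _)) (start i bs) (Equivalence.from T-≡ ok) (start-sound i bs bounded)
    (map⁺ (All.universal chosen (subsets _)))
  where
  chosen : ∀ A → Any (Chosen (pad i G)) (halves A)
  chosen A with P , Q , s , p , q ← g A
           with Split⇒∈halves s
  ... | inj₁ h = List.lose h (Available⇒pad {G = G} p , Available⇒pad {G = G} q)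
  ... | inj₂ h = List.lose h (Available⇒pad {G = G} q , Available⇒pad {G = G} p)

refuted⇒> : ∀ i (bs : Vec ℕ (suc n)) {G : Family (suc n)} → T (feasible i bs) →
  refutes (map halves (subsets (suc n))) (start i bs) ≡ true → Splits i G → head bs < card (atLeast i G)
refuted⇒> i bs feas ok g = ≰⇒> λ G≤b →
  let r , bounded = ordering i bs feas g G≤b in
  refuted⇒¬Bounded i bs ok (Splits-act r g) bounded

-- Starting one below the claimed minimum, each entry is the least one that
-- `feasible` admits after its predecessor.
budgets₂ budgets₃ : Vec ℕ 7
budgets₂ = 14 ∷ 9 ∷ 5 ∷ 2 ∷ 1 ∷ 0 ∷ 0 ∷ []
budgets₃ = 5 ∷ 2 ∷ 1 ∷ 0 ∷ 0 ∷ 0 ∷ 0 ∷ []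

refuted₂ : refutes (map halves (subsets 7)) (start 2 budgets₂) ≡ true
refuted₂ = refl

refuted₃ : refutes (map halves (subsets 7)) (start 3 budgets₃) ≡ true
refuted₃ = refl

seven₂ : {G : Family 7} → Splits 2 G → 15 ≤ card (atLeast 2 G)
seven₂ = refuted⇒> 2 budgets₂ tt refuted₂

seven₃ : {G : Family 7} → Splits 3 G → 6 ≤ card (atLeast 3 G)
seven₃ = refuted⇒> 3 budgets₃ tt refuted₃

Split-∪ : Split P Q A → P ∪ Q ≡ A
Split-∪ [] = refl
Split-∪ (neither s) = cong (outside ∷_) (Split-∪ s)
Split-∪ (left s) = cong (inside ∷_) (Split-∪ s)
Split-∪ (right s) = cong (inside ∷_) (Split-∪ s)

Split-disjoint : Split P Q A → Disjoint P Q
Split-disjoint (neither s) (suc x , there x∈) = Split-disjoint s (x , x∈)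
Split-disjoint (left s) (suc x , there x∈) = Split-disjoint s (x , x∈)
Split-disjoint (right s) (suc x , there x∈) = Split-disjoint s (x , x∈)

disjoint⇒Split : ∀ (P Q : Subset n) → Disjoint P Q → Split P Q (P ∪ Q)
disjoint⇒Split [] [] d = []
disjoint⇒Split (outside ∷ P) (outside ∷ Q) d = neither (disjoint⇒Split P Q (drop-∷-Empty d))
disjoint⇒Split (inside ∷ P) (outside ∷ Q) d = left (disjoint⇒Split P Q (drop-∷-Empty d))
disjoint⇒Split (outside ∷ P) (inside ∷ Q) d = right (disjoint⇒Split P Q (drop-∷-Empty d))
disjoint⇒Split (inside ∷ P) (inside ∷ Q) d = contradiction (zero , here) d

Split-⊥ʳ : ∀ (A : Subset n) → Split A ⊥ A
Split-⊥ʳ [] = []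
Split-⊥ʳ (outside ∷ A) = neither (Split-⊥ʳ A)
Split-⊥ʳ (inside ∷ A) = left (Split-⊥ʳ A)

Split-injectiveˡ : ∀ {P P′ Q A : Subset n} → Split P Q A → Split P′ Q A → P ≡ P′
Split-injectiveˡ [] [] = refl
Split-injectiveˡ (neither s) (neither s′) = cong (outside ∷_) (Split-injectiveˡ s s′)
Split-injectiveˡ (left s) (left s′) = cong (inside ∷_) (Split-injectiveˡ s s′)
Split-injectiveˡ (right s) (right s′) = cong (outside ∷_) (Split-injectiveˡ s s′)

∣p∣<1⇒p≡⊥ : ∀ (p : Subset n) → ∣ p ∣ < 1 → p ≡ ⊥
∣p∣<1⇒p≡⊥ [] _ = refl
∣p∣<1⇒p≡⊥ (outside ∷ p) p<1 = cong (outside ∷_) (∣p∣<1⇒p≡⊥ p p<1)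
∣p∣<1⇒p≡⊥ (inside ∷ p) (s≤s ())

⊆-tight : ∀ {p q : Subset n} → p ⊆ q → ∣ q ∣ ≤ ∣ p ∣ → p ≡ q
⊆-tight {p = []} {[]} _ _ = refl
⊆-tight {p = outside ∷ p} {outside ∷ q} p⊆q q≤p = cong (outside ∷_) (⊆-tight (drop-∷-⊆ p⊆q) q≤p)
⊆-tight {p = outside ∷ p} {inside ∷ q} p⊆q q<p = contradiction q<p (≤⇒≯ (p⊆q⇒∣p∣≤∣q∣ (drop-∷-⊆ p⊆q)))
⊆-tight {p = inside ∷ p} {outside ∷ q} p⊆q _ with () ← p⊆q here
⊆-tight {p = inside ∷ p} {inside ∷ q} p⊆q (s≤s q≤p) = cong (inside ∷_) (⊆-tight (drop-∷-⊆ p⊆q) q≤p)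

∣⊥∣<1 : ∀ n → ∣ ⊥ {n} ∣ < 1
∣⊥∣<1 n = s≤s (≤-reflexive (∣⊥∣≡0 n))

generator⇒Splits : {G : Family n} → IsGenerator 2 G → Splits 1 G
generator⇒Splits {n} {G} gen A with nonempty? A
... | no A≡∅ = A , ⊥ , Split-⊥ʳ A , inj₁ (subst (λ S → ∣ S ∣ < 1) (sym (Empty-unique A≡∅)) (∣⊥∣<1 n)) , inj₁ (∣⊥∣<1 n)
... | yes A≢∅ with gen A A≢∅
...   | [] , _ , _ , _ , refl = ⊥ , ⊥ , Split-⊥ʳ ⊥ , inj₁ (∣⊥∣<1 n) , inj₁ (∣⊥∣<1 n)
...   | P ∷ [] , _ , P∈G ∷ [] , _ , refl =
  P , ⊥ , subst (Split P ⊥) (sym (∪-identityʳ P)) (Split-⊥ʳ P) , inj₂ P∈G , inj₁ (∣⊥∣<1 n)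
...   | P ∷ Q ∷ [] , _ , P∈G ∷ Q∈G ∷ [] , (d ∷ []) ∷ _ , refl =
  P , Q , subst (λ R → Split P Q (P ∪ R)) (sym (∪-identityʳ Q)) (disjoint⇒Split P Q d) , inj₂ P∈G , inj₂ Q∈G
...   | _ ∷ _ ∷ _ ∷ _ , s≤s (s≤s ()) , _

Available₁ : ∀ (G : Family n) S → 1 ≤ ∣ S ∣ → Available 1 G S → T (G S)
Available₁ G S 1≤S (inj₁ S<1) = contradiction 1≤S (<⇒≱ S<1)
Available₁ G S 1≤S (inj₂ S∈G) = S∈G

singleton-member : ∀ {G : Family n} → Splits 1 G → ∀ A → ∣ A ∣ ≡ 1 → T (G A)
singleton-member {G = G} g A A≡1 with g A
... | P , Q , s , p , q with ∣ P ∣ <? 1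
...   | yes P<1 = subst (T ∘ G) Q≡A (Available₁ G Q (subst (λ S → 1 ≤ ∣ S ∣) (sym Q≡A) (≤-reflexive (sym A≡1))) q)
  where
  Q≡A : Q ≡ A
  Q≡A = Split-injectiveˡ (subst (λ P → Split Q P A) (∣p∣<1⇒p≡⊥ P P<1) (Split-swap s)) (Split-⊥ʳ A)
...   | no P≮1 = subst (T ∘ G) P≡A (Available₁ G P (≮⇒≥ P≮1) p)
  where
  Q<1 : ∣ Q ∣ < 1
  Q<1 = s≤s (+-cancelˡ-≤ 1 ∣ Q ∣ 0 (≤-trans (+-monoˡ-≤ ∣ Q ∣ (≮⇒≥ P≮1)) (≤-reflexive (trans (Split-size s) A≡1))))
  P≡A : P ≡ A
  P≡A = Split-injectiveˡ (subst (λ Q → Split P Q A) (∣p∣<1⇒p≡⊥ Q Q<1) s) (Split-⊥ʳ A)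

card-∖-average : ∀ m i c (G : Family (suc n)) → (∀ v → c ≤ card (atLeast i (G ∖ v))) →
  suc n * c + cards m i G ≤ (suc n ∸ i) * card (atLeast i G)
card-∖-average m i c G c≤ = ≤-trans (+-monoˡ-≤ (cards m i G) (sum-≥ c (λ v → card (atLeast i (G ∖ v))) c≤))
  (deletion-average m i G)

module _ {G : Family 8} (g : Splits 1 G) where

  private
    N : ℕ → ℕ
    N i = card (atLeast i G)

  eight₄ : 2 ≤ N 4
  eight₄ = *-cancelˡ-< 4 1 (N 4) (≤-trans (m≤m+n 5 3)
    (card-∖-average 0 4 1 G λ v → large-member 3 (m≤m+n 7 0)
      (Splits-mono {G = G ∖ v} (m≤m+n 1 2) (Splits-∖ {G = G} v g))))

  eight₃ : 10 ≤ N 3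
  eight₃ = *-cancelˡ-< 5 9 (N 3) (≤-trans (m≤m+n 46 2)
    (card-∖-average 0 3 6 G λ v → seven₃ (Splits-mono {G = G ∖ v} (m≤m+n 1 2) (Splits-∖ {G = G} v g))))

  pair-average : 120 + (N 3 + (N 4 + (N 5 + 0))) ≤ 6 * N 2
  pair-average = card-∖-average 3 2 15 G λ v → seven₂ (Splits-mono {G = G ∖ v} (m≤m+n 1 1) (Splits-∖ {G = G} v g))

  eight₂ : 22 ≤ N 2
  eight₂ = *-cancelˡ-< 6 21 (N 2) (≤-trans (m≤m+n 127 5) (≤-trans
    (+-monoʳ-≤ 120 (+-mono-≤ eight₃ (≤-trans eight₄ (m≤m+n (N 4) (N 5 + 0))))) pair-average))

  singletons : 8 + N 2 ≤ N 1
  singletons = begin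
    8 + N 2
      ≡⟨ cong (8 +_) (card≡∑ (atLeast 2 G)) ⟩
    ∑ {8} (λ S → 𝟙 (∣ S ∣ ≡ᵇ 1)) + ∑ (𝟙 ∘ atLeast 2 G)
      ≡⟨ ∑-+ (λ S → 𝟙 (∣ S ∣ ≡ᵇ 1)) (𝟙 ∘ atLeast 2 G) ⟨
    ∑ (λ S → 𝟙 (∣ S ∣ ≡ᵇ 1) + 𝟙 (atLeast 2 G S))
      ≤⟨ ∑-mono pointwise ⟩
    ∑ (𝟙 ∘ atLeast 1 G)
      ≡⟨ card≡∑ (atLeast 1 G) ⟨
    N 1 ∎
    where
    open ≤-Reasoning
    pointwise : ∀ S → 𝟙 (∣ S ∣ ≡ᵇ 1) + 𝟙 (atLeast 2 G S) ≤ 𝟙 (atLeast 1 G S)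
    pointwise S with ∣ S ∣ in eq
    ... | 0 = ≤-refl
    ... | suc (suc _) = ≤-refl
    ... | 1 with G S in S∈G
    ...   | true = ≤-refl
    ...   | false = ⊥-elim (subst T S∈G (singleton-member {G = G} g S eq))

  eight₁ : 30 ≤ N 1
  eight₁ = ≤-trans (+-monoʳ-≤ 8 eight₂) singletons

  large-star : ∃[ z ] 8 ≤ card (star z G)
  large-star = sum-≥-any 7 (λ z → card (star z G)) (≤-trans (m≤m+n 57 7) (≤-trans
    (+-mono-≤ eight₁ (+-mono-≤ eight₂ (+-mono-≤ eight₃ (+-monoˡ-≤ 0 eight₄)))) (sum-stars 4 G)))

  module _ (G≤30 : card G ≤ 30) where

    N₂≤22 : N 2 ≤ 22
    N₂≤22 = +-cancelˡ-≤ 8 (N 2) 22 (≤-trans singletons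
      (≤-trans (card-mono {F = atLeast 1 G} {G} λ S → proj₁ ∘ Equivalence.to (T-∧ {G S})) G≤30))

    N₃+≤12 : N 3 + (N 4 + (N 5 + 0)) ≤ 12
    N₃+≤12 = +-cancelˡ-≤ 120 _ 12 (≤-trans pair-average (*-monoʳ-≤ 6 N₂≤22))

    N₃≤10 : N 3 ≤ 10
    N₃≤10 = +-cancelʳ-≤ 2 (N 3) 10 (≤-trans (+-monoʳ-≤ (N 3) (≤-trans eight₄ (m≤m+n (N 4) _))) N₃+≤12)

    N₄+≤2 : N 4 + (N 5 + 0) ≤ 2
    N₄+≤2 = +-cancelˡ-≤ 10 _ 2 (≤-trans (+-monoˡ-≤ _ eight₃) N₃+≤12)

    N₄≤2 : N 4 ≤ 2
    N₄≤2 = ≤-trans (m≤m+n (N 4) _) N₄+≤2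

    N₅≤0 : N 5 ≤ 0
    N₅≤0 = ≤-trans (m≤m+n (N 5) 0) (+-cancelˡ-≤ 2 _ 0 (≤-trans (+-monoˡ-≤ _ eight₄) N₄+≤2))

Split-⊆ˡ : Split P Q A → P ⊆ A
Split-⊆ˡ {P = P} {Q} s x∈P = subst (_ ∈_) (Split-∪ s) (p⊆p∪q Q x∈P)

∈Constr⁺ : ∀ {V W : Subset n} S → 1 ≤ ∣ S ∣ → S ⊆ V ⊎ S ⊆ W → T (Constr V W S)
∈Constr⁺ {n} {V} {W} S 1≤S S⊆ = fromWitness {a? = nonempty? S ×-dec (S ⊆? V ⊎-dec S ⊆? W)} (nonempty , S⊆)
  where
  nonempty : Nonempty S
  nonempty with nonempty? S
  ... | yes S≢∅ = S≢∅
  ... | no S≡∅ = contradiction (≤-trans 1≤S (≤-reflexive (trans (cong ∣_∣ (Empty-unique S≡∅)) (∣⊥∣≡0 n)))) λ ()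

∈Constr⁻ : ∀ {V W : Subset n} S → T (Constr V W S) → Nonempty S × (S ⊆ V ⊎ S ⊆ W)
∈Constr⁻ {V = V} {W} S = toWitness {a? = nonempty? S ×-dec (S ⊆? V ⊎-dec S ⊆? W)}

Nonempty⇒1≤ : ∀ (S : Subset n) → Nonempty S → 1 ≤ ∣ S ∣
Nonempty⇒1≤ (inside ∷ S) _ = s≤s z≤n
Nonempty⇒1≤ (outside ∷ S) (suc x , there x∈S) = Nonempty⇒1≤ S (x , x∈S)

Constr-generator : ∀ (V W : Subset n) → V ∪ W ≡ ⊤ → Disjoint V W → IsGenerator 2 (Constr V W)
Constr-generator {n} V W V∪W≡⊤ V#W A A≢∅ = pieces (nonempty? (A ∩ V)) (nonempty? (A ∩ W))
  where
  A≡ : (A ∩ V) ∪ (A ∩ W) ≡ A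
  A≡ = trans (sym (∩-distribˡ-∪ A V W)) (trans (cong (A ∩_) V∪W≡⊤) (∩-identityʳ A))
  V∈ : Nonempty (A ∩ V) → T (Constr V W (A ∩ V))
  V∈ ne = ∈Constr⁺ (A ∩ V) (Nonempty⇒1≤ _ ne) (inj₁ (p∩q⊆q A V))
  W∈ : Nonempty (A ∩ W) → T (Constr V W (A ∩ W))
  W∈ ne = ∈Constr⁺ (A ∩ W) (Nonempty⇒1≤ _ ne) (inj₂ (p∩q⊆q A W))
  pieces : Dec (Nonempty (A ∩ V)) → Dec (Nonempty (A ∩ W)) → DisjointUnion≤ 2 (Constr V W) A
  pieces (yes v) (yes w) = A ∩ V ∷ A ∩ W ∷ [] , ≤-refl , V∈ v ∷ W∈ w ∷ [] , (disjoint ∷ []) ∷ [] ∷ [] ,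
    trans (cong (A ∩ V ∪_) (∪-identityʳ (A ∩ W))) A≡
    where
    disjoint : Disjoint (A ∩ V) (A ∩ W)
    disjoint (x , x∈) with x∈V , x∈W ← x∈p∩q⁻ (A ∩ V) (A ∩ W) x∈ =
      V#W (x , x∈p∩q⁺ (p∩q⊆q A V x∈V , p∩q⊆q A W x∈W))
  pieces (yes v) (no w) = A ∩ V ∷ [] , s≤s z≤n , V∈ v ∷ [] , [] ∷ [] ,
    trans (cong (A ∩ V ∪_) (sym (Empty-unique w))) A≡
  pieces (no v) (yes w) = A ∩ W ∷ [] , s≤s z≤n , W∈ w ∷ [] , [] ∷ [] ,
    trans (∪-comm (A ∩ W) ⊥) (trans (cong (_∪ (A ∩ W)) (sym (Empty-unique v))) A≡)
  pieces (no v) (no w) = contradiction (subst Nonempty (trans (sym A≡)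
    (trans (cong₂ _∪_ (Empty-unique v) (Empty-unique w)) (∪-identityˡ ⊥))) A≢∅) ∉⊥′
    where
    ∉⊥′ : ¬ Nonempty (⊥ {n})
    ∉⊥′ (x , x∈) = ∉⊥ x∈

all≡true⇒All : ∀ {X : Set} (p : X → Bool) xs → all p xs ≡ true → All (T ∘ p) xs
all≡true⇒All p xs eq = all⁺ p xs (Equivalence.from T-≡ eq)

halving-profile : Option 8 → Bool
halving-profile (V , W) = not (∣ V ∣ ≡ᵇ 4) ∨
  ((card (Constr V W) ≡ᵇ 30) ∧ ((size 1 ≡ᵇ 30) ∧ ((size 2 ≡ᵇ 22) ∧ ((size 3 ≡ᵇ 10) ∧ (size 4 ≡ᵇ 2)))))
  where
  size : ℕ → ℕ
  size i = card (atLeast i (Constr V W))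

halving-profiles : all halving-profile (splits ⊤) ≡ true
halving-profiles = refl

record ConstrSizes (V W : Subset 8) : Set where
  field
    size  : card (Constr V W) ≡ 30
    size₁ : card (atLeast 1 (Constr V W)) ≡ 30
    size₂ : card (atLeast 2 (Constr V W)) ≡ 22
    size₃ : card (atLeast 3 (Constr V W)) ≡ 10
    size₄ : card (atLeast 4 (Constr V W)) ≡ 2

constr-sizes : ∀ {V W : Subset 8} → Split V W ⊤ → ∣ V ∣ ≡ 4 → ConstrSizes V W
constr-sizes {V} {W} s V≡4 =
  [ (λ V≢4 → ⊥-elim (subst (λ k → T (not (k ≡ᵇ 4))) V≡4 V≢4)) , sizes ]′
    (Equivalence.to (T-∨ {not (∣ V ∣ ≡ᵇ 4)}) (All.lookup checked (Split⇒∈splits s)))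
  where
  checked : All (T ∘ halving-profile) (splits ⊤)
  checked = all≡true⇒All halving-profile (splits ⊤) halving-profiles
  sizes : _ → _
  sizes t =
    let c , t₁ = Equivalence.to T-∧ t
        c₁ , t₂ = Equivalence.to T-∧ t₁
        c₂ , t₃ = Equivalence.to T-∧ t₂
        c₃ , c₄ = Equivalence.to T-∧ t₃
    in record { size = ≡ᵇ⇒≡ _ _ c ; size₁ = ≡ᵇ⇒≡ _ _ c₁ ; size₂ = ≡ᵇ⇒≡ _ _ c₂
              ; size₃ = ≡ᵇ⇒≡ _ _ c₃ ; size₄ = ≡ᵇ⇒≡ _ _ c₄ }

halving⇒Split : ∀ {V W} → IsHalving V W → Split V W ⊤
halving⇒Split {V} {W} h = subst (Split V W) (IsHalving.covers h) (disjoint⇒Split V W (IsHalving.disjoint h))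

-- X ∪ Q has j + 4 elements, so if one part of a split has at most j of them
-- and the other lies inside Q, then the other is all of Q and the first is X.
complement-member : ∀ {j} {G : Family n} {X Q R S : Subset n} → 1 ≤ j → ∣ X ∣ ≡ j → ∣ Q ∣ ≡ 4 →
  Split X Q (X ∪ Q) → Split R S (X ∪ Q) → ∣ R ∣ ≤ j → S ⊆ Q → Available 1 G R → T (G X)
complement-member {j = j} {G} {X} {Q} {R} {S} 1≤j X≡j Q≡4 s s′ R≤j S⊆Q r =
  subst (T ∘ G) R≡X (Available₁ G R (subst (λ P → 1 ≤ ∣ P ∣) (sym R≡X) (subst (1 ≤_) (sym X≡j) 1≤j)) r)
  where
  sizes : ∣ R ∣ + ∣ S ∣ ≡ j + 4
  sizes = trans (Split-size s′) (trans (sym (Split-size s)) (cong₂ _+_ X≡j Q≡4))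
  S≡Q : S ≡ Q
  S≡Q = ⊆-tight S⊆Q (subst (_≤ ∣ S ∣) (sym Q≡4)
    (+-cancelˡ-≤ j 4 ∣ S ∣ (≤-trans (≤-reflexive (sym sizes)) (+-monoˡ-≤ ∣ S ∣ R≤j))))
  R≡X : R ≡ X
  R≡X = Split-injectiveˡ (subst (λ S → Split R S (X ∪ Q)) S≡Q s′) s

fill : ∀ {j} {G : Family n} {P Q X : Subset n} → Splits 1 G → 1 ≤ j → j < 4 → Disjoint P Q → ∣ Q ∣ ≡ 4 →
  (∀ S → T (G S) → j < ∣ S ∣ → S ⊆ P ⊎ S ⊆ Q) → X ⊆ P → ∣ X ∣ ≡ j → T (G X)
fill {n} {j} {G} {P} {Q} {X} g 1≤j j<4 P#Q Q≡4 large X⊆P X≡j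
  with R , S , s , r , t ← g (X ∪ Q)
  = cases (shape (Split-⊆ˡ s) r) (shape (Split-⊆ˡ (Split-swap s)) t)
  where
  X#Q : Disjoint X Q
  X#Q (x , x∈) with x∈X , x∈Q ← x∈p∩q⁻ X Q x∈ = P#Q (x , x∈p∩q⁺ (X⊆P x∈X , x∈Q))
  sXQ : Split X Q (X ∪ Q)
  sXQ = disjoint⇒Split X Q X#Q
  sizes : ∣ R ∣ + ∣ S ∣ ≡ j + 4
  sizes = trans (Split-size s) (trans (sym (Split-size sXQ)) (cong₂ _+_ X≡j Q≡4))
  shape : ∀ {R} → R ⊆ X ∪ Q → Available 1 G R → ∣ R ∣ ≤ j ⊎ R ⊆ Q
  shape R⊆ (inj₁ R<1) = inj₁ (≤-trans (<⇒≤ R<1) 1≤j)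
  shape {R} R⊆ (inj₂ R∈G) with j <? ∣ R ∣
  ... | no j≮R = inj₁ (≮⇒≥ j≮R)
  ... | yes j<R with large R R∈G j<R
  ...   | inj₂ R⊆Q = inj₂ R⊆Q
  ...   | inj₁ R⊆P = inj₁ (subst (∣ R ∣ ≤_) X≡j (p⊆q⇒∣p∣≤∣q∣ λ x∈R →
    [ (λ x∈X → x∈X) , (λ x∈Q → contradiction (_ , x∈p∩q⁺ (R⊆P x∈R , x∈Q)) P#Q) ]′ (x∈p∪q⁻ X Q (R⊆ x∈R))))
  cases : ∣ R ∣ ≤ j ⊎ R ⊆ Q → ∣ S ∣ ≤ j ⊎ S ⊆ Q → T (G X)
  cases (inj₁ R≤j) (inj₂ S⊆Q) = complement-member 1≤j X≡j Q≡4 sXQ s R≤j S⊆Q r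
  cases (inj₂ R⊆Q) (inj₁ S≤j) = complement-member 1≤j X≡j Q≡4 sXQ (Split-swap s) S≤j R⊆Q t
  cases (inj₁ R≤j) (inj₁ S≤j) = contradiction
    (+-cancelˡ-≤ j 4 j (≤-trans (≤-reflexive (sym sizes)) (+-mono-≤ R≤j S≤j))) (<⇒≱ j<4)
  cases (inj₂ R⊆Q) (inj₂ S⊆Q) = contradiction
    (subst₂ _≤_ (trans (Split-size s) (trans (sym (Split-size s)) sizes)) Q≡4
      (subst (_≤ ∣ Q ∣) (sym (Split-size s)) (p⊆q⇒∣p∣≤∣q∣ λ x∈ →
        [ R⊆Q , S⊆Q ]′ (x∈p∪q⁻ R S (subst (_ ∈_) (sym (Split-∪ s)) x∈)))))
    (<⇒≱ (+-monoˡ-≤ 4 1≤j))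

module _ {G : Family 8} (g : Splits 1 G) (G≤30 : card G ≤ 30) where

  member-≤4 : ∀ S → T (G S) → ∣ S ∣ ≤ 4
  member-≤4 S S∈G = ≮⇒≥ λ 4<S →
    card≡0⇒∉ (atLeast 5 G) (N₅≤0 g G≤30) S (Equivalence.from (T-∧ {G S}) (S∈G , ≤⇒≤ᵇ 4<S))

  available-≤4 : ∀ S → Available 1 G S → ∣ S ∣ ≤ 4
  available-≤4 S (inj₁ S<1) = ≤-trans (<⇒≤ S<1) (s≤s z≤n)
  available-≤4 S (inj₂ S∈G) = member-≤4 S S∈G

  halves-determine : ∀ {V W} → Split V W ⊤ → Available 1 G V → Available 1 G W →
    IsHalving V W × G ≗ Constr V W
  halves-determine {V} {W} s v w = halving , λ S → sym (card-tight {F = Constr V W} {G} Constr⊆G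
      (≤-trans G≤30 (≤-reflexive (sym (ConstrSizes.size sizes)))) S)
    where
    V≡4 : ∣ V ∣ ≡ 4
    V≡4 = ≤-antisym (available-≤4 V v) (+-cancelʳ-≤ 4 4 ∣ V ∣
      (≤-trans (≤-reflexive (sym (Split-size s))) (+-monoʳ-≤ ∣ V ∣ (available-≤4 W w))))
    W≡4 : ∣ W ∣ ≡ 4
    W≡4 = +-cancelˡ-≡ 4 ∣ W ∣ 4 (trans (cong (_+ ∣ W ∣) (sym V≡4)) (Split-size s))
    halving : IsHalving V W
    halving = record { covers = Split-∪ s ; disjoint = Split-disjoint s ; size₁ = V≡4 ; size₂ = W≡4 }
    C : Family 8
    C = Constr V W
    sizes : ConstrSizes V W
    sizes = constr-sizes s V≡4
    open ConstrSizes sizes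
    V∈G : T (G V)
    V∈G = Available₁ G V (subst (1 ≤_) (sym V≡4) (s≤s z≤n)) v
    W∈G : T (G W)
    W∈G = Available₁ G W (subst (1 ≤_) (sym W≡4) (s≤s z≤n)) w
    Full : ℕ → Set
    Full j = ∀ S → T (C S) → j ≤ ∣ S ∣ → T (G S)
    full₄ : Full 4
    full₄ S S∈C 4≤S with proj₂ (∈Constr⁻ S S∈C)
    ... | inj₁ S⊆V = subst (T ∘ G) (sym (⊆-tight S⊆V (subst (_≤ ∣ S ∣) (sym V≡4) 4≤S))) V∈G
    ... | inj₂ S⊆W = subst (T ∘ G) (sym (⊆-tight S⊆W (subst (_≤ ∣ S ∣) (sym W≡4) 4≤S))) W∈G
    exact : ∀ j → Full j → card (atLeast j G) ≤ card (atLeast j C) →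
      ∀ S → T (G S) → j ≤ ∣ S ∣ → S ⊆ V ⊎ S ⊆ W
    exact j full G≤C S S∈G j≤S = proj₂ (∈Constr⁻ S (proj₁ (Equivalence.to (T-∧ {C S})
      (subst T (sym (card-tight {F = atLeast j C} {atLeast j G} sub G≤C S))
        (Equivalence.from (T-∧ {G S}) (S∈G , ≤⇒≤ᵇ j≤S))))))
      where
      sub : ∀ S → T (atLeast j C S) → T (atLeast j G S)
      sub S S∈ = let S∈C , j≤ᵇS = Equivalence.to (T-∧ {C S}) S∈ in
        Equivalence.from (T-∧ {G S}) (full S S∈C (≤ᵇ⇒≤ j ∣ S ∣ j≤ᵇS) , j≤ᵇS)
    extend : ∀ j → 1 ≤ j → j < 4 → (∀ S → T (G S) → j < ∣ S ∣ → S ⊆ V ⊎ S ⊆ W) →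
      ∀ S → T (C S) → j ≡ ∣ S ∣ → T (G S)
    extend j 1≤j j<4 large S S∈C j≡S with proj₂ (∈Constr⁻ S S∈C)
    ... | inj₁ S⊆V = fill g 1≤j j<4 (Split-disjoint s) W≡4 large S⊆V (sym j≡S)
    ... | inj₂ S⊆W = fill g 1≤j j<4 (Split-disjoint (Split-swap s)) V≡4
                       (λ R R∈G j<R → Sum.swap (large R R∈G j<R)) S⊆W (sym j≡S)
    descend : ∀ j {c} → 1 ≤ j → j < 4 → card (atLeast (suc j) C) ≡ c → card (atLeast (suc j) G) ≤ c →
      Full (suc j) → Full j
    descend j 1≤j j<4 C≡c G≤c full S S∈C j≤S =
      [ full S S∈C
      , extend j 1≤j j<4 (exact (suc j) full (≤-trans G≤c (≤-reflexive (sym C≡c)))) S S∈C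
      ]′ (m≤n⇒m<n∨m≡n j≤S)
    full₁ : Full 1
    full₁ =
      descend 1 (s≤s z≤n) (m≤m+n 2 2) size₂ (N₂≤22 g G≤30)
      (descend 2 (s≤s z≤n) (m≤m+n 3 1) size₃ (N₃≤10 g G≤30)
      (descend 3 (s≤s z≤n) (m≤m+n 4 0) size₄ (N₄≤2 g G≤30) full₄))
    Constr⊆G : ∀ S → T (C S) → T (G S)
    Constr⊆G S S∈C = full₁ S S∈C (Nonempty⇒1≤ S (proj₁ (∈Constr⁻ S S∈C)))

  unique : ∃[ V ] ∃[ W ] IsHalving V W × G ≗ Constr V W
  unique = let V , W , s , v , w = g ⊤ in V , W , halves-determine s v w

first-half : Subset 8
first-half = inside ∷ inside ∷ inside ∷ inside ∷ outside ∷ outside ∷ outside ∷ outside ∷ []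

standard-halving : IsHalving first-half (∁ first-half)
standard-halving = record
  { covers = refl ; disjoint = from-no (nonempty? (first-half ∩ ∁ first-half)) ; size₁ = refl ; size₂ = refl }

card-Constr : ∀ {V W} → IsHalving V W → card (Constr V W) ≡ 30
card-Constr h = ConstrSizes.size (constr-sizes (halving⇒Split h) (IsHalving.size₁ h))

halving-generator : ∀ {V W} → IsHalving V W → IsGenerator 2 (Constr V W)
halving-generator h = Constr-generator _ _ (IsHalving.covers h) (IsHalving.disjoint h)

lower-bounds : ∀ {G : Family 8} → Splits 1 G → ∀ {V W} → IsHalving V W → ∀ i → 1 ≤ i → i ≤ 4 →
  card (atLeast i (Constr V W)) ≤ card (atLeast i G)
lower-bounds {G} g {V} {W} h = bound
  where
  open ConstrSizes (constr-sizes (halving⇒Split h) (IsHalving.size₁ h))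
  bound : ∀ i → 1 ≤ i → i ≤ 4 → card (atLeast i (Constr V W)) ≤ card (atLeast i G)
  bound 1 _ _ = ≤-trans (≤-reflexive size₁) (eight₁ g)
  bound 2 _ _ = ≤-trans (≤-reflexive size₂) (eight₂ g)
  bound 3 _ _ = ≤-trans (≤-reflexive size₃) (eight₃ g)
  bound 4 _ _ = ≤-trans (≤-reflexive size₄) (eight₄ g)
  bound (suc (suc (suc (suc (suc _))))) _ (s≤s (s≤s (s≤s (s≤s ()))))

corollary2 : ((G : Family 8) → IsGenerator 2 G →
    (∀ (V₁ V₂ : Subset 8) → IsHalving V₁ V₂ →
    ∀ (i : ℕ) → 1 ≤ i → i ≤ 4 →
    card (atLeast i G) ≥ card (atLeast i (Constr V₁ V₂)))
    × (∃[ z ] card (star z G) ≥ 2 ^ 3))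
    × ((G : Family 8) → IsOptimalGenerator 2 G →
    ∃[ V₁ ] ∃[ V₂ ] IsHalving V₁ V₂ × G ≗ Constr V₁ V₂)
    × (∀ (V₁ V₂ : Subset 8) → IsHalving V₁ V₂ →
    IsOptimalGenerator 2 (Constr V₁ V₂))
corollary2 =
    (λ G gen → (λ _ _ → lower-bounds (generator⇒Splits gen)) , large-star (generator⇒Splits gen))
  , (λ { G (gen , minimal) → unique (generator⇒Splits gen)
         (≤-trans (minimal _ (halving-generator standard-halving)) (≤-reflexive (card-Constr standard-halving))) })
  , (λ V W h → halving-generator h , λ H gen → ≤-trans (≤-reflexive (card-Constr h))
      (≤-trans (eight₁ (generator⇒Splits gen))
        (card-mono {F = atLeast 1 H} {H} λ S → proj₁ ∘ Equivalence.to (T-∧ {H S}))))
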